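{- There is a randomized algorithm that reconstructs any connected chordal graph $G$ of maximum degree $\Delta$ using a distance oracle, with expected query complexity $$O\big(\Delta^3 2^\Delta\cdot n(2^\Delta+\log^2 n)\log n\big),$$ which is $\tilde O(n)$ when $\Delta=O(\log\log n)$.
   Context: Let $G=(V,E)$ be an unknown connected, unweighted, undirected simple graph with $|V|=n$, and let $\delta$ be its shortest-path metric. A distance oracle receives $(u,v)\in V^2$ and returns $\delta(u,v)$. In the reconstruction problem, the algorithm is given $V$ (and the degree bound $\Delta$), has access to the oracle, and must output $E$. A graph is chordal if every cycle of length greater than three has a chord (an edge joining two nonconsecutive vertices of the cycle). -}

module Defs where

open import Algebra.Definitions.RawMonoid using (sum)
open import Data.Bool.Base using (Bool; true; false; T)
open import Data.Bool.Properties using (T?)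
open import Data.Fin.Base using (Fin; toℕ)
open import Data.Fin.Properties using (_≟_; any?)
open import Data.Fin.Subset using (Subset; ∣_∣)
open import Data.Integer.Base using (+_)
open import Data.Nat.Base using (ℕ; zero; suc; _+_; _*_; _^_; _≤_; _<_; _≥_; z≤n; s≤s; NonZero)
open import Data.Nat.DivMod using (_mod_)
open import Data.Nat.Logarithm using (⌊log₂_⌋)
open import Data.Product.Base using (∃; ∃-syntax; _×_; _,_; proj₁)
open import Data.Rational.Base as ℚ using (ℚ; 0ℚ; 1ℚ)
open import Data.Vec.Base using (tabulate)
open import Function.Definitions using (Injective)
open import Relation.Binary.PropositionalEquality using (_≡_; _≢_; refl)
open import Relation.Nullary.Decidable using (yes; no; map′; _×-dec_)
open import Relation.Nullary.Negation using (contradiction)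
open import Relation.Unary using (Decidable)

EdgeSet : ℕ → Set
EdgeSet n = Fin n → Fin n → Bool

record Graph (n : ℕ) : Set where
  field
    edge        : EdgeSet n
    symmetric   : ∀ u v → edge u v ≡ edge v u
    irreflexive : ∀ v → edge v v ≡ false

  Adjacent : Fin n → Fin n → Set
  Adjacent u v = T (edge u v)

  neighbours : Fin n → Subset n
  neighbours v = tabulate (edge v)

  degree : Fin n → ℕ
  degree v = ∣ neighbours v ∣

open Graph public

MaxDegree≤ : ∀ {n} → Graph n → ℕ → Set
MaxDegree≤ G Δ = ∀ v → degree G v ≤ Δ

-- Walk G u v k: a walk with k edges from u to v.
data Walk {n} (G : Graph n) : Fin n → Fin n → ℕ → Set where
  nil  : ∀ {v} → Walk G v v 0
  cons : ∀ {u w v k} → Adjacent G u w → Walk G w v k → Walk G u v (suc k)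

Connected : ∀ {n} → Graph n → Set
Connected G = ∀ u v → ∃[ k ] Walk G u v k

walk? : ∀ {n} (G : Graph n) u v → Decidable (Walk G u v)
walk? G u v zero = map′ (λ { refl → nil }) (λ { nil → refl }) (u ≟ v)
walk? G u v (suc k) =
  map′ (λ { (_ , e , p) → cons e p }) (λ { (cons e p) → _ , e , p })
       (any? λ w → T? (edge G u w) ×-dec walk? G w v k)

Least : (ℕ → Set) → ℕ → Set
Least P d = P d × (∀ k → P k → d ≤ k)

least : ∀ {P : ℕ → Set} → Decidable P → ∀ m → P m → ∃ (Least P)
least P? zero    p = zero , p , λ _ _ → z≤n
least P? (suc m) p with P? zero
... | yes p₀ = zero , p₀ , λ _ _ → z≤n
... | no ¬p₀ with least (λ k → P? (suc k)) m p
...   | d , pd , min = suc d , pd , λ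
          { zero    p₀ → contradiction p₀ ¬p₀
          ; (suc k) pk → s≤s (min k pk)
          }

shortestWalk : ∀ {n} (G : Graph n) → Connected G → ∀ u v → ∃ (Least (Walk G u v))
shortestWalk G conn u v = let k , p = conn u v in least (walk? G u v) k p

distance : ∀ {n} (G : Graph n) → Connected G → Fin n → Fin n → ℕ
distance G conn u v = proj₁ (shortestWalk G conn u v)

next : ∀ {k} .{{_ : NonZero k}} → Fin k → Fin k
next {k} i = suc (toℕ i) mod k

-- This describes a graph-theoretic cycle only for k ≥ 3.
record IsCycle {n} (G : Graph n) {k} .{{_ : NonZero k}} (c : Fin k → Fin n) : Set where
  field
    distinct    : Injective _≡_ _≡_ c
    consecutive : ∀ i → Adjacent G (c i) (c (next i))

HasChord : ∀ {n} (G : Graph n) {k} .{{_ : NonZero k}} → (Fin k → Fin n) → Set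
HasChord G c = ∃[ i ] ∃[ j ] (j ≢ next i × i ≢ next j × Adjacent G (c i) (c j))

Chordal : ∀ {n} → Graph n → Set
Chordal {n} G =
  ∀ k .{{_ : NonZero k}} → 3 < k → (c : Fin k → Fin n) → IsCycle G c → HasChord G c

-- Randomized query algorithms on the vertex set Fin n, as decision trees:
-- query u v f continues as f d when the oracle answers d, and
-- sample k f continues as f i for i uniform in Fin k, independently of all
-- earlier samples. Internal computation is free.
data Algorithm (n : ℕ) (A : Set) : Set where
  return : A → Algorithm n A
  query  : (u v : Fin n) → (ℕ → Algorithm n A) → Algorithm n A
  sample : (k : ℕ) .{{_ : NonZero k}} → (Fin k → Algorithm n A) → Algorithm n A

mean : ∀ {k} .{{_ : NonZero k}} → (Fin k → ℚ) → ℚ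
mean {k} f = (+ 1 ℚ./ k) ℚ.* sum ℚ.+-0-rawMonoid f

expectedQueries : ∀ {n A} → (Fin n → Fin n → ℕ) → Algorithm n A → ℚ
expectedQueries δ (return _)    = 0ℚ
expectedQueries δ (query u v f) = 1ℚ ℚ.+ expectedQueries δ (f (δ u v))
expectedQueries δ (sample k f)  = mean {k} λ i → expectedQueries δ (f i)

-- Every outcome of the random choices leads to an output satisfying P. All
-- outcomes have positive probability, so this is correctness with probability 1.
AlwaysReturns : ∀ {n A} → (Fin n → Fin n → ℕ) → (A → Set) → Algorithm n A → Set
AlwaysReturns δ P (return a)    = P a
AlwaysReturns δ P (query u v f) = AlwaysReturns δ P (f (δ u v))
AlwaysReturns δ P (sample k f)  = ∀ i → AlwaysReturns δ P (f i)

Reconstructs : ∀ {n} (G : Graph n) → Connected G → Algorithm n (EdgeSet n) → Set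
Reconstructs G conn = AlwaysReturns (distance G conn) (λ E → ∀ u v → E u v ≡ edge G u v)

-- For n ≥ 2, ⌊log₂ n⌋ and log n agree up to constant factors; using the floor
-- makes the bound no larger than with the real logarithm.
queryBound : ℕ → ℕ → ℕ
queryBound n Δ = Δ ^ 3 * 2 ^ Δ * (n * (2 ^ Δ + ⌊log₂ n ⌋ ^ 2) * ⌊log₂ n ⌋)

infix 4 _∈O_ _∈Õ_

_∈O_ : (ℕ → ℕ) → (ℕ → ℕ) → Set
f ∈O g = ∃[ C ] ∃[ n₀ ] ∀ n → n ≥ n₀ → f n ≤ C * g n

_∈Õ_ : (ℕ → ℕ) → (ℕ → ℕ) → Set
f ∈Õ g = ∃[ k ] f ∈O (λ n → g n * ⌊log₂ n ⌋ ^ k)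

{-# OPTIONS --safe #-}
-- The algorithm is deterministic. After querying the distances ℓ from a root r,
-- it inserts the vertices by increasing level ℓ into the known induced subgraph H.
--
-- A lower neighbour of a new vertex v is found by searching the graph of shortest
-- paths from r. The state is an ancestor x of v together with the list S of
-- descendants of x, one level below v, that may still be adjacent to v. Following
-- heavy children from x leads to a vertex y that either lies in the level of S, or
-- has between |S| / 2Δ and |S| / 2 of S below it; asking whether y is an ancestor
-- of v then multiplies |S| by at most 1 − 1/2Δ or reaches a neighbour of v.
-- So O(Δ log n) queries suffice, and chordality is not needed for this part.
--
-- Chordality enters through one fact: two neighbours of v that are joined by a walk
-- avoiding N[v] in between are adjacent. Walks through r show that every neighbour
-- of v in H is within distance 2 in H of any lower neighbour of v, so O(Δ²) further
-- queries determine all of them.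
module Submission where

open import Defs
open import Data.Bool.Base using (Bool; true; false; T; _∧_; _∨_; if_then_else_)
open import Data.Bool.Properties using (T?; ∧-comm; ∨-comm)
open import Data.Fin.Base using (Fin; zero; suc; toℕ; fromℕ; fromℕ<; inject₁)
open import Data.Fin.Properties using
  (_≟_; any?; toℕ-injective; toℕ-fromℕ; toℕ-fromℕ<; toℕ-inject₁; toℕ<n; toℕ≤pred[n])
open import Data.Fin.Relation.Unary.Top using (view; ‵fromℕ; ‵inject₁)
open import Data.Fin.Subset using (∣_∣)
open import Data.Integer.Base as ℤ using (+_)
import Data.Integer.Properties as ℤ
open import Data.List.Base as List using (List; []; _∷_; _++_; length; filter; allFin; concatMap)
open import Data.List.Membership.Propositional using (_∈_; _∉_; lose)
open import Data.List.Membership.Propositional.Properties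
  using (∈-allFin; ∈-concatMap⁺; ∈-filter⁺; ∈-filter⁻; ∈-length; ∈-++⁺ˡ; ∈-++⁺ʳ)
open import Data.List.Properties using (filter-all; length-++; length-filter; length-tabulate)
open import Data.List.Relation.Binary.Permutation.Propositional using (↭-sym)
open import Data.List.Relation.Binary.Permutation.Propositional.Properties using (∈-resp-↭; ↭-length)
open import Data.List.Relation.Unary.All as All using (All)
open import Data.List.Relation.Unary.AllPairs using (AllPairs; []; _∷_)
open import Data.List.Relation.Unary.Any as Any using (Any; here; there)
import Data.List.Relation.Unary.Sorted.TotalOrder.Properties as Sorted
import Data.List.Sort as Sort
open import Data.Nat.Base
open import Data.Nat.DivMod using (_%_; m<n⇒m%n≡m; n%n≡0)
open import Data.Nat.Induction using (<-rec)
open import Data.Nat.Logarithm using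
  (⌊log₂_⌋; ⌊log₂⌋-mono-≤; ⌊log₂⌊n/2⌋⌋≡⌊log₂n⌋∸1; ⌊log₂[2^n]⌋≡n)
open import Data.Nat.Properties as ℕ hiding (_≟_)
open import Data.Nat.Tactic.RingSolver using (solve-∀)
open import Data.Product.Base using (Σ-syntax; ∃-syntax; _×_; _,_; proj₁; proj₂)
open import Data.Rational.Base as ℚ using (1ℚ)
import Data.Rational.Properties as ℚ
open import Data.Rational.Unnormalised.Base as ℚᵘ using (mkℚᵘ; *≡*)
import Data.Rational.Unnormalised.Properties as ℚᵘ
open import Data.Sum.Base using (_⊎_; inj₁; inj₂; [_,_]′)
open import Data.Vec.Base as Vec using ()
open import Function.Base using (_∘_)
open import Level using (0ℓ)
open import Relation.Binary.Bundles using (DecTotalOrder)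
import Relation.Binary.Construct.On as On
open import Relation.Binary.Definitions using (tri<; tri≈; tri>)
open import Relation.Binary.PropositionalEquality
open import Relation.Nullary.Decidable using (Dec; yes; no; does; dec-false; ¬?; _×-dec_; _⊎-dec_; _→-dec_)
open import Relation.Nullary.Negation using (contradiction; ¬_)
open import Relation.Unary using (Decidable)
open import Relation.Unary.Properties using (∁?)

private variable
  n k l : ℕ
  A B : Set
  P Q : A → Set
  G H : Graph n
  u v w : Fin n

-- Sequencing query algorithms and bounding their cost

infixl 1 _>>=_

_>>=_ : Algorithm n A → (A → Algorithm n B) → Algorithm n B
return a    >>= g = g a
query u v f >>= g = query u v λ d → f d >>= g
sample k f  >>= g = sample k λ i → f i >>= g

-- `ℚ./` normalises by a gcd that does not compute for a variable `k`, so the equation is checked on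
-- unnormalised representatives.
1+k/1 : ∀ k → 1ℚ ℚ.+ (+ k ℚ./ 1) ≡ + suc k ℚ./ 1
1+k/1 k = ℚ.toℚᵘ-injective (begin-equality
  ℚ.toℚᵘ (1ℚ ℚ.+ (+ k ℚ./ 1))            ≃⟨ ℚ.toℚᵘ-homo-+ 1ℚ (+ k ℚ./ 1) ⟩
  ℚᵘ.1ℚᵘ ℚᵘ.+ ℚ.toℚᵘ (+ k ℚ./ 1)         ≃⟨ ℚᵘ.+-congʳ ℚᵘ.1ℚᵘ (ℚ.toℚᵘ-fromℚᵘ (mkℚᵘ (+ k) 0)) ⟩
  ℚᵘ.1ℚᵘ ℚᵘ.+ mkℚᵘ (+ k) 0               ≃⟨ *≡* (cong (λ i → (+ 1 ℤ.+ i) ℤ.* + 1) (ℤ.*-identityʳ (+ k))) ⟩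
  mkℚᵘ (+ suc k) 0                       ≃⟨ ℚ.toℚᵘ-fromℚᵘ (mkℚᵘ (+ suc k) 0) ⟨
  ℚ.toℚᵘ (+ suc k ℚ./ 1)                 ∎)
  where open ℚᵘ.≤-Reasoning

-- There is no constructor for `sample`, so the bound is a worst-case bound and the output is
-- certain. A query is followed only along the true answer `δ u v`.
data Within {n A} (δ : Fin n → Fin n → ℕ) (P : A → Set) : ℕ → Algorithm n A → Set where
  return : ∀ {k a} → P a → Within δ P k (return a)
  query  : ∀ {k u v f} → Within δ P k (f (δ u v)) → Within δ P (suc k) (query u v f)

module _ {δ : Fin n → Fin n → ℕ} where

  within-≤ : ∀ {k l m} → k ≤ l → Within δ P k m → Within δ P l m
  within-≤ _         (return p) = return p
  within-≤ (s≤s k≤l) (query w)  = query (within-≤ k≤l w)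

  within->>= : ∀ {k l m} {f : A → Algorithm n B} → Within δ P k m →
               (∀ {a} → P a → Within δ Q l (f a)) → Within δ Q (k + l) (m >>= f)
  within->>= {k = k} (return p) g = within-≤ (m≤n+m _ k) (g p)
  within->>= (query w)          g = query (within->>= w g)

  within⇒alwaysReturns : ∀ {k m} → Within δ P k m → AlwaysReturns δ P m
  within⇒alwaysReturns (return p) = p
  within⇒alwaysReturns (query w)  = within⇒alwaysReturns w

  within⇒expectedQueries≤ : ∀ {k m} → Within δ P k m → expectedQueries δ m ℚ.≤ + k ℚ./ 1
  within⇒expectedQueries≤ {k = k} (return _) = ℚ.nonNegative⁻¹ _ {{ℚ.normalize-nonNeg k 1}}
  within⇒expectedQueries≤ {k = suc k} (query w) =
    ℚ.≤-trans (ℚ.+-monoʳ-≤ 1ℚ (within⇒expectedQueries≤ w)) (ℚ.≤-reflexive (1+k/1 k))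

  within-if : ∀ {X : Set} {k} {m m′ : Algorithm n A} (x? : Dec X) →
              (X → Within δ P k m) → (¬ X → Within δ P k m′) →
              Within δ P k (if does x? then m else m′)
  within-if (yes x) t e = t x
  within-if (no ¬x) t e = e ¬x

does-true : {A : Set} (a? : Dec A) → A → T (does a?)
does-true (yes _) _ = _
does-true (no ¬a) a = ¬a a

true-does : {A : Set} (a? : Dec A) → T (does a?) → A
true-does (yes a) _ = a

-- Walks and shortest walks

adjacent-sym : (G : Graph n) → Adjacent G u v → Adjacent G v u
adjacent-sym G = subst T (symmetric G _ _)

adjacent⇒≢ : (G : Graph n) → Adjacent G u v → u ≢ v
adjacent⇒≢ {u = u} G e refl = subst T (irreflexive G u) e

snoc : Walk G u v k → Adjacent G v w → Walk G u w (suc k)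
snoc nil         e = cons e nil
snoc (cons e′ p) e = cons e′ (snoc p e)

unsnoc : Walk G u v (suc k) → ∃[ w ] Walk G u w k × Adjacent G w v
unsnoc (cons e nil)           = _ , nil , e
unsnoc (cons e p@(cons _ _)) with w , q , e′ ← unsnoc p = w , cons e q , e′

infixr 5 _++ʷ_

_++ʷ_ : Walk G u v k → Walk G v w l → Walk G u w (k + l)
nil      ++ʷ q = q
cons e p ++ʷ q = cons e (p ++ʷ q)

reverse : Walk G u v k → Walk G v u k
reverse         nil        = nil
reverse {G = G} (cons e p) = snoc (reverse p) (adjacent-sym G e)

at : ∀ {k} → Walk {n} G u v k → Fin (suc k) → Fin n
at {u = u} _          zero    = u
at         (cons _ p) (suc i) = at p i

at-last : (p : Walk G u v k) → at p (fromℕ k) ≡ v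
at-last nil        = refl
at-last (cons _ p) = at-last p

at-step : (p : Walk G u v k) (i : Fin k) → Adjacent G (at p (inject₁ i)) (at p (suc i))
at-step (cons e p) zero    = e
at-step (cons _ p) (suc i) = at-step p i

suffix : (p : Walk G u v k) (i : Fin (suc k)) → Walk G (at p i) v (k ∸ toℕ i)
suffix p          zero    = p
suffix (cons _ p) (suc i) = suffix p i

prefix : (p : Walk G u v k) (i : Fin (suc k)) → Walk G u (at p i) (toℕ i)
prefix p          zero    = nil
prefix (cons e p) (suc i) = cons e (prefix p i)

module _ (p : Walk G u v k) (p-shortest : ∀ l → Walk G u v l → k ≤ l) where

  -- A shorter walk to `at p i`, continued by the suffix of `p`, would beat `p`.
  shortest⇒toℕ≤ : ∀ i {l} → Walk G u (at p i) l → toℕ i ≤ l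
  shortest⇒toℕ≤ i {l} q = +-cancelʳ-≤ (k ∸ toℕ i) (toℕ i) l
    (≤-trans (≤-reflexive (m+[n∸m]≡n (toℕ≤pred[n] i))) (p-shortest _ (q ++ʷ suffix p i)))

  at-injective : ∀ i j → at p i ≡ at p j → i ≡ j
  at-injective i j eq = toℕ-injective (≤-antisym
    (shortest⇒toℕ≤ i (subst (λ x → Walk G u x _) (sym eq) (prefix p j)))
    (shortest⇒toℕ≤ j (subst (λ x → Walk G u x _) eq (prefix p i))))

  -- An edge skipping ahead would give a shortcut, so a shortest walk is an induced path.
  at-adjacent : ∀ i j → Adjacent G (at p i) (at p j) → toℕ j ≡ suc (toℕ i) ⊎ toℕ i ≡ suc (toℕ j)
  at-adjacent i j e with <-cmp (toℕ i) (toℕ j)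
  ... | tri< i<j _ _ = inj₁ (≤-antisym (shortest⇒toℕ≤ j (snoc (prefix p i) e)) i<j)
  ... | tri≈ _ i≡j _ = contradiction (cong (at p) (toℕ-injective i≡j)) (adjacent⇒≢ G e)
  ... | tri> _ _ j<i = inj₂ (≤-antisym (shortest⇒toℕ≤ i (snoc (prefix p j) (adjacent-sym G e))) j<i)

-- Chordless cycles through a vertex

next-≡ : (i j : Fin (suc k)) → toℕ j ≡ suc (toℕ i) → j ≡ next i
next-≡ {k} i j eq = sym (toℕ-injective (begin
  toℕ (next i)            ≡⟨ toℕ-fromℕ< _ ⟩
  suc (toℕ i) % suc k     ≡⟨ cong (_% suc k) eq ⟨
  toℕ j % suc k           ≡⟨ m<n⇒m%n≡m (toℕ<n j) ⟩
  toℕ j                   ∎))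
  where open ≡-Reasoning

zero≡next-last : ∀ k → zero ≡ next (fromℕ k)
zero≡next-last k = sym (toℕ-injective (begin
  toℕ (next (fromℕ k))            ≡⟨ toℕ-fromℕ< _ ⟩
  suc (toℕ (fromℕ k)) % suc k     ≡⟨ cong (λ m → suc m % suc k) (toℕ-fromℕ k) ⟩
  suc k % suc k                   ≡⟨ n%n≡0 (suc k) ⟩
  0                               ∎))
  where open ≡-Reasoning

module _ (G : Graph n) (v a b : Fin n) where

  Avoids : Fin n → Set
  Avoids x = x ≢ v × (Adjacent G v x → x ≡ a ⊎ x ≡ b)

  avoids? : ∀ x → Dec (Avoids x)
  avoids? x = ¬? (x ≟ v) ×-dec (T? (edge G v x) →-dec (x ≟ a ⊎-dec x ≟ b))

  avoiding-edge? : ∀ x y → Dec (Adjacent G x y × Avoids x × Avoids y)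
  avoiding-edge? x y = T? (edge G x y) ×-dec avoids? x ×-dec avoids? y

  avoiding : Graph n
  avoiding = record
    { edge        = λ x y → does (avoiding-edge? x y)
    ; symmetric   = λ x y → cong₂ _∧_ (symmetric G x y) (∧-comm (does (avoids? x)) (does (avoids? y)))
    ; irreflexive = λ x → cong (_∧ (does (avoids? x) ∧ does (avoids? x))) (irreflexive G x)
    }

  avoiding⁺ : ∀ {x y} → Adjacent G x y → Avoids x → Avoids y → Adjacent avoiding x y
  avoiding⁺ {x} {y} e ax ay = does-true (avoiding-edge? x y) (e , ax , ay)

  avoiding⁻ : ∀ {x y} → Adjacent avoiding x y → Adjacent G x y × Avoids x × Avoids y
  avoiding⁻ {x} {y} = true-does (avoiding-edge? x y)

  -- The start has to be assumed, since the empty walk exists at every vertex; each later vertex is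
  -- the end of a kept edge.
  at-avoids : ∀ {x y} → Avoids x → (p : Walk avoiding x y k) → ∀ i → Avoids (at p i)
  at-avoids ax p          zero    = ax
  at-avoids ax (cons e p) (suc i) = at-avoids (proj₂ (proj₂ (avoiding⁻ e))) p i

-- A shortest walk from a to b avoiding N[v] in between closes up through v to a cycle
-- without chords, which has more than three vertices unless a = b or a ~ b.
chordal⇒adjacent : (G : Graph n) → Chordal G → ∀ {v a b} → Adjacent G v a → Adjacent G v b →
                   Walk (avoiding G v a b) a b k → a ≡ b ⊎ Adjacent G a b
chordal⇒adjacent {n} G chordal {v} {a} {b} va vb p₀ with least (walk? (avoiding G v a b) a b) _ p₀
... | zero          , nil        , _     = inj₁ refl
... | suc zero      , cons e nil , _     = inj₂ (proj₁ (avoiding⁻ G v a b e))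
... | suc (suc m-2) , p          , p-min =
  -- `p` has `m ≥ 2` edges and thus `m + 1` vertices; together with `v` the cycle has `m + 2 ≥ 4`.
  contradiction (chordal (suc (suc m)) (s≤s (s≤s (s≤s (s≤s z≤n)))) c isCycle) ¬chord
  where
  m = suc (suc m-2)
  c : Fin (suc (suc m)) → Fin n
  c zero    = v
  c (suc i) = at p i

  avoids : ∀ i → Avoids G v a b (at p i)
  avoids = at-avoids G v a b ((λ a≡v → adjacent⇒≢ G va (sym a≡v)) , λ _ → inj₁ refl) p

  ≡b⇒last : ∀ i → at p i ≡ b → suc i ≡ fromℕ (suc m)
  ≡b⇒last i eq = cong suc (at-injective p p-min i (fromℕ m) (trans eq (sym (at-last p))))

  isCycle : IsCycle G c
  isCycle = record { distinct = distinct _ _ ; consecutive = consecutive }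
    where
    distinct : ∀ i j → c i ≡ c j → i ≡ j
    distinct zero    zero    _  = refl
    distinct zero    (suc j) eq = contradiction (sym eq) (proj₁ (avoids j))
    distinct (suc i) zero    eq = contradiction eq (proj₁ (avoids i))
    distinct (suc i) (suc j) eq = cong suc (at-injective p p-min i j eq)

    consecutive : ∀ i → Adjacent G (c i) (c (next i))
    consecutive i with view i
    -- The last index carries `b`, and the edge from `b` to `v` closes the cycle.
    ... | ‵fromℕ =
      subst₂ (λ x j → Adjacent G x (c j)) (sym (at-last p)) (zero≡next-last (suc m)) (adjacent-sym G vb)
    ... | ‵inject₁ j =
      subst (λ j′ → Adjacent G (c (inject₁ j)) (c j′))
            (next-≡ (inject₁ j) (suc j) (cong suc (sym (toℕ-inject₁ j)))) (step j)
      where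
      step : ∀ j → Adjacent G (c (inject₁ j)) (c (suc j))
      step zero    = va
      step (suc j) = proj₁ (avoiding⁻ G v a b (at-step p j))

  -- `p` meets the neighbourhood of `v` only in `a` and `b`, which are the successor and the
  -- predecessor of `v` on the cycle.
  ¬chord-v : ∀ i → suc i ≢ next zero → zero ≢ next (suc i) → ¬ Adjacent G v (at p i)
  ¬chord-v i ≢next next≢ e with proj₂ (avoids i) e
  ... | inj₁ ≡a = ≢next (trans (cong suc (at-injective p p-min i zero ≡a)) (next-≡ zero (suc zero) refl))
  ... | inj₂ ≡b = next≢ (trans (zero≡next-last (suc m)) (cong next (sym (≡b⇒last i ≡b))))

  ¬chord : ¬ HasChord G c
  ¬chord (zero  , zero  , _     , _     , e) = adjacent⇒≢ G e refl
  ¬chord (zero  , suc j , ≢next , next≢ , e) = ¬chord-v j ≢next next≢ e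
  ¬chord (suc i , zero  , ≢next , next≢ , e) = ¬chord-v i next≢ ≢next (adjacent-sym G e)
  ¬chord (suc i , suc j , ≢next , next≢ , e)
    -- `p` is shortest only among walks in `avoiding G v a b`, so the chord is first moved into that
    -- graph.
    with at-adjacent p p-min i j (avoiding⁺ G v a b e (avoids i) (avoids j))
  ... | inj₁ j≡1+i = ≢next (next-≡ (suc i) (suc j) (cong suc j≡1+i))
  ... | inj₂ i≡1+j = next≢ (next-≡ (suc j) (suc i) (cong suc i≡1+j))

-- Levels from a root and lower neighbours in chordal graphs

Lipschitz : Graph n → (Fin n → ℕ) → Set
Lipschitz G ℓ = ∀ {x y} → Adjacent G x y → ℓ y ≤ suc (ℓ x)

lipschitz-walk : {ℓ : Fin n → ℕ} → Lipschitz G ℓ → Walk G u v k → ℓ v ≤ ℓ u + k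
lipschitz-walk {u = u} {ℓ = ℓ} lip nil = ≤-reflexive (sym (+-identityʳ (ℓ u)))
lipschitz-walk {u = u} {ℓ = ℓ} lip (cons {k = k} e p) =
  ≤-trans (lipschitz-walk lip p) (≤-trans (+-monoˡ-≤ k (lip e)) (≤-reflexive (sym (+-suc (ℓ u) k))))

-- These fields pin `ℓ` down as the distance from `r`: `attained` bounds it from below, `root` and
-- `lipschitz` from above.
record Levels (G : Graph n) (r : Fin n) (ℓ : Fin n → ℕ) : Set where
  field
    root      : ℓ r ≡ 0
    lipschitz : Lipschitz G ℓ
    attained  : ∀ x → Walk G r x (ℓ x)

  walk-from-root : Walk G r u k → ℓ u ≤ k
  walk-from-root {u} {k} p = subst (λ m → ℓ u ≤ m + k) root (lipschitz-walk lipschitz p)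

  parent : 0 < ℓ u → ∃[ q ] ℓ q < ℓ u × Adjacent G q u
  parent {u} 0<ℓu with ℓ u | attained u
  ... | suc k | p with q , p′ , e ← unsnoc p = q , s≤s (walk-from-root p′) , e

module _ {G : Graph n} (chordal : Chordal G) {r : Fin n} {ℓ : Fin n → ℕ} (levels : Levels G r ℓ) where
  open Levels levels

  module _ {v a b : Fin n} where

    -- Neighbours of `v` are at most one level below it.
    low⇒avoids : ∀ {x} → suc (ℓ x) < ℓ v → Avoids G v a b x
    low⇒avoids {x} lt = (λ { refl → <-asym lt ≤-refl }) ,
                        λ e → contradiction (lipschitz (adjacent-sym G e)) (<⇒≱ lt)

    -- Before its end, a walk from the root with fewer than `ℓ v` edges stays at least two levels
    -- below `v`; so only the end needs a hypothesis.
    avoiding-from-root : ∀ {x k} → k < ℓ v → Avoids G v a b x → Walk G r x k → Walk (avoiding G v a b) r x k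
    avoiding-from-root {k = zero}  _   _ nil = nil
    avoiding-from-root {k = suc k} k<ℓv avoids p with q , p′ , e ← unsnoc p =
      snoc (avoiding-from-root (<-trans (n<1+n k) k<ℓv) q-avoids p′)
           (avoiding⁺ G v a b e q-avoids avoids)
      where
      q-avoids : Avoids G v a b q
      q-avoids = low⇒avoids (≤-<-trans (s≤s (walk-from-root p′)) k<ℓv)

    avoiding-via-root : ∀ {x y} → ℓ x < ℓ v → Avoids G v a b x → ℓ y < ℓ v → Avoids G v a b y →
                        ∃[ k ] Walk (avoiding G v a b) x y k
    avoiding-via-root x<v x-avoids y<v y-avoids =
      _ , reverse (avoiding-from-root x<v x-avoids (attained _)) ++ʷ avoiding-from-root y<v y-avoids (attained _)

  end-avoids : ∀ {v a b x} → Adjacent G v x → x ≡ a ⊎ x ≡ b → Avoids G v a b x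
  end-avoids vx x≡ = (λ x≡v → adjacent⇒≢ G vx (sym x≡v)) , λ _ → x≡

  -- Going from `a` to the root and on to `b` avoids `N[v]` in between.
  lower-neighbours-adjacent : ∀ {v a b} → Adjacent G v a → ℓ a < ℓ v → Adjacent G v b → ℓ b < ℓ v →
                              a ≡ b ⊎ Adjacent G a b
  lower-neighbours-adjacent va a<v vb b<v = chordal⇒adjacent G chordal va vb
    (proj₂ (avoiding-via-root a<v (end-avoids va (inj₁ refl)) b<v (end-avoids vb (inj₂ refl))))

  -- For `w` below `v`, use `lower-neighbours-adjacent`. Otherwise let `q` be a parent of `w`, which
  -- lies below `v`. If `q` is adjacent to `v`, then `a` is `q` or adjacent to it. If not, the walk
  -- from `a` through the root and `q` to `w` avoids `N[v]` in between, so `chordal⇒adjacent`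
  -- applies. The bound on `ℓ q` ensures that `q` is inserted before `v`.
  near-lower-neighbour : ∀ {v a w} → Adjacent G v a → ℓ a < ℓ v → Adjacent G v w → ℓ w ≤ ℓ v →
                         a ≡ w ⊎ Adjacent G a w ⊎ ∃[ q ] ℓ q < ℓ v × Adjacent G a q × Adjacent G q w
  near-lower-neighbour {v} {a} {w} va a<v vw w≤v with m≤n⇒m<n∨m≡n w≤v
  ... | inj₁ w<v with lower-neighbours-adjacent va a<v vw w<v
  ...   | inj₁ a≡w = inj₁ a≡w
  ...   | inj₂ aw  = inj₂ (inj₁ aw)
  near-lower-neighbour {v} {a} {w} va a<v vw w≤v | inj₂ w≡v
    with q , q<w , qw ← parent (subst (0 <_) (sym w≡v) (≤-<-trans z≤n a<v))
    with q<v ← subst (ℓ q <_) w≡v q<w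
    with T? (edge G v q)
  ... | yes vq with lower-neighbours-adjacent va a<v vq q<v
  ...   | inj₁ refl = inj₂ (inj₁ qw)
  ...   | inj₂ aq   = inj₂ (inj₂ (q , q<v , aq , qw))
  near-lower-neighbour {v} {a} {w} va a<v vw w≤v | inj₂ w≡v | no ¬vq
    with chordal⇒adjacent G chordal va vw (snoc
           (proj₂ (avoiding-via-root a<v (end-avoids va (inj₁ refl)) q<v q-avoids))
           (avoiding⁺ G v a w qw q-avoids (end-avoids vw (inj₂ refl))))
    where
    q-avoids : Avoids G v a w q
    q-avoids = (λ { refl → <-irrefl refl q<v }) , λ vq → contradiction vq ¬vq
  ... | inj₁ a≡w = inj₁ a≡w
  ... | inj₂ aw  = inj₂ (inj₁ aw)

-- Counting in lists

module _ {A : Set} where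

  count : {P : A → Set} → Decidable P → List A → ℕ
  count P? xs = length (filter P? xs)

  count-∪ : {P Q R : A → Set} (P? : Decidable P) (Q? : Decidable Q) (R? : Decidable R) →
            (∀ {x} → P x → Q x ⊎ R x) → ∀ xs → count P? xs ≤ count Q? xs + count R? xs
  count-∪ P? Q? R? P⊆Q∪R [] = z≤n
  count-∪ P? Q? R? P⊆Q∪R (x ∷ xs) with ih ← count-∪ P? Q? R? P⊆Q∪R xs | P? x | Q? x | R? x
  ... | yes _ | yes _ | yes _ = s≤s (≤-trans ih (+-monoʳ-≤ (count Q? xs) (n≤1+n _)))
  ... | yes _ | yes _ | no _  = s≤s ih
  ... | yes _ | no _  | yes _ = ≤-trans (s≤s ih) (≤-reflexive (sym (+-suc (count Q? xs) _)))
  ... | yes p | no ¬q | no ¬r = contradiction (P⊆Q∪R p) [ ¬q , ¬r ]′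
  ... | no _  | yes _ | yes _ = ≤-trans ih (+-mono-≤ (n≤1+n _) (n≤1+n _))
  ... | no _  | yes _ | no _  = m≤n⇒m≤1+n ih
  ... | no _  | no _  | yes _ = ≤-trans ih (+-monoʳ-≤ (count Q? xs) (n≤1+n _))
  ... | no _  | no _  | no _  = ih

  count-⊆ : {P Q : A → Set} (P? : Decidable P) (Q? : Decidable Q) →
            (∀ {x} → P x → Q x) → ∀ xs → count P? xs ≤ count Q? xs
  count-⊆ P? Q? P⊆Q [] = z≤n
  count-⊆ P? Q? P⊆Q (x ∷ xs) with ih ← count-⊆ P? Q? P⊆Q xs | P? x | Q? x
  ... | yes _ | yes _ = s≤s ih
  ... | yes p | no ¬q = contradiction (P⊆Q p) ¬q
  ... | no _  | yes _ = m≤n⇒m≤1+n ih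
  ... | no _  | no _  = ih

  count+count-∁ : {P : A → Set} (P? : Decidable P) → ∀ xs → count P? xs + count (∁? P?) xs ≡ length xs
  count+count-∁ P? [] = refl
  count+count-∁ P? (x ∷ xs) with ih ← count+count-∁ P? xs | P? x
  ... | yes _ = cong suc ih
  ... | no _  = trans (+-suc (count P? xs) _) (cong suc ih)

  -- The union bound, with `d` in place of a division: each `y` accounts for at most `b / d`
  -- elements.
  count-Any : {B : Set} {R : B → A → Set} (R? : ∀ y → Decidable (R y)) {d b : ℕ}
              (xs : List A) (ys : List B) →
              (∀ {y} → y ∈ ys → d * count (R? y) xs ≤ b) →
              d * count (λ x → Any.any? (λ y → R? y x) ys) xs ≤ length ys * b
  count-Any R? {d} xs [] _ = ≤-reflexive (trans (cong (d *_) (none xs)) (*-zeroʳ d))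
    where
    none : ∀ xs → count (λ x → Any.any? (λ y → R? y x) []) xs ≡ 0
    none []       = refl
    none (x ∷ xs) = none xs
  count-Any {R = R} R? {d} {b} xs (y ∷ ys) small = begin
    d * count y∷ys? xs                           ≤⟨ *-monoʳ-≤ d (count-∪ y∷ys? (R? y) ys? split xs) ⟩
    d * (count (R? y) xs + count ys? xs)         ≡⟨ *-distribˡ-+ d (count (R? y) xs) _ ⟩
    d * count (R? y) xs + d * count ys? xs       ≤⟨ +-mono-≤ (small (here refl)) (count-Any R? {d} xs ys (small ∘ there)) ⟩
    b + length ys * b                            ∎
    where
    open ≤-Reasoning
    y∷ys? = λ x → Any.any? (λ z → R? z x) (y ∷ ys)
    ys?   = λ x → Any.any? (λ z → R? z x) ys
    split : ∀ {x} → Any (λ z → R z x) (y ∷ ys) → R y x ⊎ Any (λ z → R z x) ys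
    split (here r)  = inj₁ r
    split (there r) = inj₂ r

-- Searching for a lower neighbour

neighbourList : Graph n → Fin n → List (Fin n)
neighbourList G x = filter (λ y → T? (edge G x y)) (allFin _)

∈-neighbourList⁺ : (G : Graph n) → Adjacent G u v → v ∈ neighbourList G u
∈-neighbourList⁺ G e = ∈-filter⁺ (λ y → T? (edge G _ y)) (∈-allFin _) e

∈-neighbourList⁻ : (G : Graph n) → v ∈ neighbourList G u → Adjacent G u v
∈-neighbourList⁻ G v∈ = proj₂ (∈-filter⁻ (λ y → T? (edge G _ y)) {xs = allFin _} v∈)

map-walk : {H : Graph n} → (∀ {x y} → Adjacent H x y → Adjacent G x y) → Walk H u v k → Walk G u v k
map-walk f nil        = nil
map-walk f (cons e p) = cons (f e) (map-walk f p)

module Search (H : Graph n) (v : Fin n) (Δ : ℕ) where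

  below : List (Fin n) → Fin n → ℕ → List (Fin n)
  below S y j = filter (λ s → walk? H y s j) S

  notBelow : List (Fin n) → Fin n → ℕ → List (Fin n)
  notBelow S y j = filter (∁? (λ s → walk? H y s j)) S

  -- The bounds `|S| / 2Δ` and `|S| / 2` without division. The upper one is waived at `j = 0`, where
  -- a positive answer ends the search.
  Probe : Fin n → ℕ → List (Fin n) → Fin n → ℕ → Set
  Probe x k S y j =
    Walk H x y (k ∸ j)
    × length S ≤ 2 * Δ * length (below S y j)
    × (j ≡ 0 ⊎ 2 * length (below S y j) ≤ length S)

  -- Only queries are charged, so a probe may be found by trying all pairs.
  probe? : ∀ x k S → Dec (∃[ y ] ∃[ j ] Probe x k S y (toℕ {suc k} j))
  probe? x k S = any? λ y → any? λ j →
    walk? H x y (k ∸ toℕ j)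
    ×-dec length S ≤? 2 * Δ * length (below S y (toℕ j))
    ×-dec (toℕ j ℕ.≟ 0 ⊎-dec 2 * length (below S y (toℕ j)) ≤? length S)

  -- The first argument is fuel, and `x` has distance `k + 1` from `v`; so at `k = 0` it is itself a
  -- neighbour. The answers on empty fuel and on a missing probe are dummies.
  searchParent : ℕ → Fin n → ℕ → List (Fin n) → Algorithm n (Fin n)
  searchParent _       x zero    S = return x
  searchParent zero    x (suc k) S = return x
  searchParent (suc f) x (suc k) S with probe? x (suc k) S
  ... | no _            = return x
  ... | yes (y , j , _) = query y v λ d →
    if does (d ℕ.≟ suc (toℕ j))
      then searchParent f y (toℕ j) (below S y (toℕ j))
      else searchParent f x (suc k) (notBelow S y (toℕ j))

  module _ (degree≤ : ∀ x → length (neighbourList H x) ≤ Δ) (Δ>0 : 0 < Δ) where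

    -- Pigeonhole: every walk counted on the left starts with a step to one of at most `Δ`
    -- neighbours. If all of these were light, then `Δ * b ≤ Δ * (b - 1)`.
    heavy-neighbour : ∀ S y j → 0 < length (below S y (suc j)) →
                      ∃[ z ] Adjacent H y z × length (below S y (suc j)) ≤ Δ * length (below S z j)
    heavy-neighbour S y j b>0
      with any? (λ z → T? (edge H y z) ×-dec length (below S y (suc j)) ≤? Δ * length (below S z j))
    ... | yes found = found
    ... | no ¬found = contradiction Δb≤Δ[b-1]
      (<⇒≱ (*-monoʳ-< Δ {{>-nonZero Δ>0}} (≤-reflexive (suc-pred b {{>-nonZero b>0}}))))
      where
      b = length (below S y (suc j))
      N = neighbourList H y

      belowN? : ∀ s → Dec (Any (λ z → Walk H z s j) N)
      belowN? s = Any.any? (λ z → walk? H z s j) N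

      step : ∀ {s} → Walk H y s (suc j) → Any (λ z → Walk H z s j) N
      step (cons e p) = lose (∈-neighbourList⁺ H e) p

      few : ∀ {z} → z ∈ N → Δ * length (below S z j) ≤ pred b
      few {z} z∈ = <⇒≤pred (≰⇒> λ b≤ → ¬found (z , ∈-neighbourList⁻ H z∈ , b≤))

      Δb≤Δ[b-1] : Δ * b ≤ Δ * pred b
      Δb≤Δ[b-1] = begin
        Δ * b                  ≤⟨ *-monoʳ-≤ Δ (count-⊆ (λ s → walk? H y s (suc j)) belowN? step S) ⟩
        Δ * count belowN? S    ≤⟨ count-Any (λ z s → walk? H z s j) {Δ} S N few ⟩
        length N * pred b      ≤⟨ *-monoˡ-≤ (pred b) (degree≤ y) ⟩
        Δ * pred b             ∎
        where open ≤-Reasoning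

    module _ {x : Fin n} {k : ℕ} {S : List (Fin n)} where

      -- Descend through heavy neighbours while more than half of `S` stays below. The first vertex
      -- to lose the majority keeps a fraction `1 / Δ` of its predecessor's share, hence at least
      -- `|S| / 2Δ`.
      probe-below-heavy : ∀ j y → j ≤ k → Walk H x y (k ∸ j) → length S < 2 * length (below S y j) →
                          ∃[ y ] ∃[ j ] j ≤ k × Probe x k S y j
      probe-below-heavy zero y j≤k p heavy = y , 0 , j≤k , p , (begin
        length S                          ≤⟨ <⇒≤ heavy ⟩
        2 * length (below S y 0)          ≤⟨ *-monoˡ-≤ (length (below S y 0)) (m≤m*n 2 Δ {{>-nonZero Δ>0}}) ⟩
        2 * Δ * length (below S y 0)      ∎) , inj₁ refl
        where open ≤-Reasoning
      probe-below-heavy (suc j) y j<k p heavy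
        with z , e , b≤ ← heavy-neighbour S y j (*-cancelˡ-< 2 0 _ (≤-<-trans z≤n heavy))
        with z-walk ← subst (Walk H x z) (sym (+-∸-assoc 1 j<k)) (snoc p e)
        with 2 * length (below S z j) ≤? length S
      ... | no ¬light = probe-below-heavy j z (<⇒≤ j<k) z-walk (≰⇒> ¬light)
      ... | yes light = z , j , <⇒≤ j<k , z-walk , (begin
        length S                          ≤⟨ <⇒≤ heavy ⟩
        2 * length (below S y (suc j))    ≤⟨ *-monoʳ-≤ 2 b≤ ⟩
        2 * (Δ * length (below S z j))    ≡⟨ *-assoc 2 Δ _ ⟨
        2 * Δ * length (below S z j)      ∎) , inj₂ light
        where open ≤-Reasoning

      probe-exists : 0 < length S → (∀ {s} → s ∈ S → Walk H x s k) →
                     ∃[ y ] ∃[ j ] Probe x k S y (toℕ {suc k} j)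
      probe-exists S>0 S-below
        with y , j , j≤k , probe ← probe-below-heavy k x ≤-refl (subst (Walk H x x) (sym (n∸n≡0 k)) nil)
               -- The descent starts at `x`, below which lies all of the nonempty `S`.
               (subst (λ S′ → length S < 2 * length S′) (sym (filter-all (λ s → walk? H x s k) (All.tabulate S-below)))
                 (m<m+n (length S) (≤-trans S>0 (m≤m+n _ 0))))
        = y , fromℕ< (s≤s j≤k) , subst (Probe x k S y) (sym (toℕ-fromℕ< _)) probe

-- The invariant is `s * (1 - 1/(a + 1)) ^ f < 1` cleared of fractions, for `s` candidates and
-- remaining fuel `f`. One query lowers `f` by one and scales `s` by at most `a / (a + 1)`.
potential-step : ∀ a f s s′ → suc a * s′ ≤ a * s → s * a ^ suc f < suc a ^ suc f → s′ * a ^ f < suc a ^ f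
potential-step a f s s′ shrink small = *-cancelˡ-< (suc a) _ _ (begin-strict
  suc a * (s′ * a ^ f)    ≡⟨ *-assoc (suc a) s′ _ ⟨
  suc a * s′ * a ^ f      ≤⟨ *-monoˡ-≤ (a ^ f) shrink ⟩
  a * s * a ^ f           ≡⟨ lemma a s (a ^ f) ⟩
  s * a ^ suc f           <⟨ small ⟩
  suc a ^ suc f           ∎)
  where
  open ≤-Reasoning
  lemma : ∀ a s x → a * s * x ≡ s * (a * x)
  lemma = solve-∀

-- `1/2 ≤ a / (a + 1)` because `a ≥ 1`.
shrink-half : ∀ a .{{_ : NonZero a}} s s′ → 2 * s′ ≤ s → suc a * s′ ≤ a * s
shrink-half a s s′ 2s′≤s = begin
  suc a * s′      ≤⟨ *-monoˡ-≤ s′ (+-monoˡ-≤ a (>-nonZero⁻¹ a)) ⟩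
  (a + a) * s′    ≡⟨ lemma a s′ ⟩
  a * (2 * s′)    ≤⟨ *-monoʳ-≤ a 2s′≤s ⟩
  a * s           ∎
  where
  open ≤-Reasoning
  lemma : ∀ a s → (a + a) * s ≡ a * (2 * s)
  lemma = solve-∀

-- The removed part `b` is at least a fraction `1 / (a + 1)` of `s`.
shrink-rest : ∀ a {s b s′} → b + s′ ≡ s → s ≤ suc a * b → suc a * s′ ≤ a * s
shrink-rest a {s} {b} {s′} split s≤ = +-cancelˡ-≤ s _ _ (begin
  s + suc a * s′            ≤⟨ +-monoˡ-≤ _ s≤ ⟩
  suc a * b + suc a * s′    ≡⟨ *-distribˡ-+ (suc a) b s′ ⟨
  suc a * (b + s′)          ≡⟨ cong (suc a *_) split ⟩
  s + a * s                 ∎)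
  where open ≤-Reasoning

pred[2*suc]≢0 : ∀ m → NonZero (pred (2 * suc m))
pred[2*suc]≢0 m = >-nonZero (≤-trans (s≤s z≤n) (m≤n+m (suc (m + 0)) m))

-- Correctness of the search

IsDistance : Graph n → (Fin n → Fin n → ℕ) → Set
IsDistance G δ = ∀ u v → Least (Walk G u v) (δ u v)

module SearchCorrect
  {G H : Graph n} {δ : Fin n → Fin n → ℕ} (isDistance : IsDistance G δ)
  {ℓ : Fin n → ℕ} (lip : Lipschitz G ℓ) (v : Fin n) (D : ℕ)
  (sound : ∀ {x y} → Adjacent H x y → Adjacent G x y)
  (complete : ∀ {x y} → ℓ x < ℓ v → ℓ y < ℓ v → Adjacent G x y → Adjacent H x y)
  (degree≤ : ∀ x → length (neighbourList H x) ≤ suc D)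
  where

  open Search H v (suc D)

  Δ = suc D
  -- `2 * Δ` reduces to `suc a`, so the potential lemmas apply as they stand.
  a = pred (2 * Δ)

  -- Every vertex of the walk stays below the level of `v`, where `H` has all edges of `G`.
  lift-walk : ∀ {x y k} → ℓ x + k < ℓ v → Walk G x y k → Walk H x y k
  lift-walk low nil = nil
  lift-walk {x} {k = suc k} low (cons {w = w} e p) =
    cons (complete (≤-<-trans (m≤m+n _ _) low) (≤-<-trans (m≤m+n (ℓ w) k) low′) e) (lift-walk low′ p)
    where
    low′ : ℓ w + k < ℓ v
    low′ = ≤-<-trans (≤-trans (+-monoˡ-≤ k (lip e)) (≤-reflexive (sym (+-suc (ℓ x) k)))) low

  -- `to-v` and `level` together force `ℓ v` to be `ℓ x + suc k`. The walk to `v` is taken in `G`,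
  -- while candidates are reached in the known graph `H`.
  record Invariant (x : Fin n) (k : ℕ) (S : List (Fin n)) : Set where
    field
      to-v       : Walk G x v (suc k)
      level      : ℓ x + suc k ≤ ℓ v
      candidate  : ∀ {s} → s ∈ S → Walk H x s k
      exhaustive : ∀ {s} → Walk H x s k → Adjacent G s v → s ∈ S

  module _ {x : Fin n} {k : ℕ} {S : List (Fin n)} (inv : Invariant x k S) where
    open Invariant inv

    -- The last vertex before `v` on the walk `to-v` is a candidate.
    candidates>0 : 0 < length S
    candidates>0 with s , p , e ← unsnoc to-v =
      ∈-length (exhaustive (lift-walk (≤-trans (≤-reflexive (sym (+-suc (ℓ x) k))) level) p) e)

    module _ {y : Fin n} {j : ℕ} (j≤k : j ≤ k) (p : Walk H x y (k ∸ j)) where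

      level-y : ℓ y + suc j ≤ ℓ x + suc k
      level-y = begin
        ℓ y + suc j                  ≤⟨ +-monoˡ-≤ (suc j) (lipschitz-walk {ℓ = ℓ} lip (map-walk {G = G} sound p)) ⟩
        ℓ x + (k ∸ j) + suc j        ≡⟨ +-assoc (ℓ x) (k ∸ j) (suc j) ⟩
        ℓ x + (k ∸ j + suc j)        ≡⟨ cong (λ m → ℓ x + m) (+-suc (k ∸ j) j) ⟩
        ℓ x + suc (k ∸ j + j)        ≡⟨ cong (λ m → ℓ x + suc m) (m∸n+n≡m j≤k) ⟩
        ℓ x + suc k                  ∎
        where open ≤-Reasoning

      -- Walks from `y` extend the walk from `x` to `y`, so no neighbour of `v` below `y` is missing
      -- from `S`.
      invariant-below : δ y v ≡ suc j → Invariant y j (below S y j)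
      invariant-below δ≡ = record
        { to-v       = subst (Walk G y v) δ≡ (proj₁ (isDistance y v))
        ; level      = ≤-trans level-y level
        ; candidate  = λ s∈ → proj₂ (∈-filter⁻ (λ s → walk? H y s j) {xs = S} s∈)
        ; exhaustive = λ q e → ∈-filter⁺ (λ s → walk? H y s j)
            (exhaustive (subst (Walk H x _) (m∸n+n≡m j≤k) (p ++ʷ q)) e) q
        }

      -- A discarded neighbour of `v` would give a walk of length `suc j` from `y` to `v`, and the
      -- levels forbid a shorter one, so `δ y v` would be `suc j`.
      invariant-notBelow : δ y v ≢ suc j → Invariant x k (notBelow S y j)
      invariant-notBelow δ≢ = record
        { to-v       = to-v
        ; level      = level
        ; candidate  = λ s∈ → candidate (proj₁ (∈-filter⁻ (∁? (λ s → walk? H y s j)) {xs = S} s∈))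
        ; exhaustive = λ q e → ∈-filter⁺ (∁? (λ s → walk? H y s j)) (exhaustive q e)
            λ q′ → δ≢ (≤-antisym (proj₂ (isDistance y v) _ (snoc (map-walk sound q′) e)) far)
        }
        where
        far : suc j ≤ δ y v
        far = +-cancelˡ-≤ (ℓ y) _ _ (≤-trans level-y (≤-trans level (lipschitz-walk lip (proj₁ (isDistance y v)))))

  IsParent : Fin n → Set
  IsParent p = Adjacent G p v × ℓ p < ℓ v

  instance
    a≢0 : NonZero a
    a≢0 = pred[2*suc]≢0 D

  -- The alternative `k ≡ 0` covers a move to `j = 0`, where `Probe` need not bound the new list but
  -- the search is over.
  searchParent-finds : ∀ f {x k S} → Invariant x k S → k ≡ 0 ⊎ length S * a ^ f < (2 * Δ) ^ f →
                       Within δ IsParent f (searchParent f x k S)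
  searchParent-finds f {x} {zero} inv _ with cons e nil ← Invariant.to-v inv =
    return (e , ≤-trans (≤-reflexive (+-comm 1 (ℓ x))) (Invariant.level inv))
  searchParent-finds zero {k = suc k} inv (inj₂ small) =
    -- Without fuel the potential says `length S < 1`.
    contradiction (candidates>0 inv) (<⇒≱ (subst (_< 1) (*-identityʳ _) small))
  searchParent-finds (suc f) {x} {suc k} {S} inv (inj₂ small) with probe? x (suc k) S
  ... | no ¬probe = contradiction
    (probe-exists degree≤ (s≤s z≤n) (candidates>0 inv) (Invariant.candidate inv)) ¬probe
  ... | yes (y , j , p , many , light) = query (within-if (δ y v ℕ.≟ suc (toℕ j))
      (λ δ≡ → searchParent-finds f (invariant-below inv (toℕ≤pred[n] j) p δ≡)
        ([ inj₁ , (λ half → inj₂ (potential-step a f (length S) b (shrink-half a (length S) b half) small)) ]′ light))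
      (λ δ≢ → searchParent-finds f (invariant-notBelow inv (toℕ≤pred[n] j) p δ≢)
        (inj₂ (potential-step a f (length S) (length (notBelow S y (toℕ j)))
          (shrink-rest a (count+count-∁ (λ s → walk? H y s (toℕ j)) S) many) small))))
    where
    b = length (below S y (toℕ j))

-- Logarithms and the query bound

2≤⇒1≤⌊log₂⌋ : ∀ {n} → 2 ≤ n → 1 ≤ ⌊log₂ n ⌋
2≤⇒1≤⌊log₂⌋ = ⌊log₂⌋-mono-≤

2*⌊n/2⌋≤n : ∀ n → 2 * ⌊ n /2⌋ ≤ n
2*⌊n/2⌋≤n n = begin
  ⌊ n /2⌋ + (⌊ n /2⌋ + 0)  ≡⟨ cong (λ x → ⌊ n /2⌋ + x) (+-identityʳ _) ⟩
  ⌊ n /2⌋ + ⌊ n /2⌋        ≤⟨ +-monoʳ-≤ ⌊ n /2⌋ (⌊n/2⌋≤⌈n/2⌉ n) ⟩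
  ⌊ n /2⌋ + ⌈ n /2⌉        ≡⟨ ⌊n/2⌋+⌈n/2⌉≡n n ⟩
  n                        ∎
  where open ≤-Reasoning

2^⌊log₂n⌋≤n : ∀ n → 1 ≤ n → 2 ^ ⌊log₂ n ⌋ ≤ n
2^⌊log₂n⌋≤n = <-rec (λ n → 1 ≤ n → 2 ^ ⌊log₂ n ⌋ ≤ n) λ
  { 1                 _  _ → ≤-refl
  ; n@(suc (suc m)) ih _ → begin
      2 ^ ⌊log₂ n ⌋                 ≡⟨ cong (2 ^_) (m+[n∸m]≡n (2≤⇒1≤⌊log₂⌋ {n} (s≤s (s≤s z≤n)))) ⟨
      2 * 2 ^ (⌊log₂ n ⌋ ∸ 1)       ≡⟨ cong (λ k → 2 * 2 ^ k) (⌊log₂⌊n/2⌋⌋≡⌊log₂n⌋∸1 n) ⟨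
      2 * 2 ^ ⌊log₂ ⌊ n /2⌋ ⌋       ≤⟨ *-monoʳ-≤ 2 (ih (⌊n/2⌋<n (suc m)) (s≤s z≤n)) ⟩
      2 * ⌊ n /2⌋                   ≤⟨ 2*⌊n/2⌋≤n n ⟩
      n                             ∎ }
  where open ≤-Reasoning

n<2^[1+⌊log₂n⌋] : ∀ n → n < 2 ^ suc ⌊log₂ n ⌋
n<2^[1+⌊log₂n⌋] n = ≰⇒> λ le →
  1+n≰n (subst (_≤ ⌊log₂ n ⌋) (⌊log₂[2^n]⌋≡n (suc ⌊log₂ n ⌋)) (⌊log₂⌋-mono-≤ le))

-- The first two terms of the binomial expansion.
bernoulli : ∀ a k → a ^ suc k + suc k * a ^ k ≤ suc a ^ suc k
bernoulli a zero    = ≤-reflexive (lemma a)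
  where
  lemma : ∀ a → a * 1 + 1 ≡ suc a * 1
  lemma = solve-∀
bernoulli a (suc k) = begin
  a * (a * a ^ k) + suc (suc k) * (a * a ^ k)           ≤⟨ m≤m+n _ (suc k * a ^ k) ⟩
  a * (a * a ^ k) + suc (suc k) * (a * a ^ k) + suc k * a ^ k  ≡⟨ lemma a (a ^ k) (suc k) ⟩
  suc a * (a * a ^ k + suc k * a ^ k)                   ≤⟨ *-monoʳ-≤ (suc a) (bernoulli a k) ⟩
  suc a * suc a ^ suc k                                 ∎
  where
  open ≤-Reasoning
  lemma : ∀ a x k → a * (a * x) + suc k * (a * x) + k * x ≡ suc a * (a * x + k * x)
  lemma = solve-∀

-- Bernoulli at `k = a`, in the form `(1 - 1/(a + 1)) ^ (a + 1) ≤ 1/2`: every `a + 1` queries halve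
-- the candidates.
2*a^[1+a]≤[1+a]^[1+a] : ∀ a → 2 * a ^ suc a ≤ suc a ^ suc a
2*a^[1+a]≤[1+a]^[1+a] a = begin
  a ^ suc a + (a ^ suc a + 0)   ≡⟨ cong (λ x → a ^ suc a + x) (+-identityʳ _) ⟩
  a ^ suc a + a * a ^ a         ≤⟨ +-monoʳ-≤ (a ^ suc a) (*-monoˡ-≤ (a ^ a) (n≤1+n a)) ⟩
  a ^ suc a + suc a * a ^ a     ≤⟨ bernoulli a a ⟩
  suc a ^ suc a                 ∎
  where open ≤-Reasoning

^-distribʳ-* : ∀ m n o → (m * n) ^ o ≡ m ^ o * n ^ o
^-distribʳ-* m n zero    = refl
^-distribʳ-* m n (suc o) = trans (cong (m * n *_) (^-distribʳ-* m n o)) (lemma m n (m ^ o) (n ^ o))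
  where
  lemma : ∀ m n x y → m * n * (x * y) ≡ m * x * (n * y)
  lemma = solve-∀

-- For `suc a = 2 * Δ` the exponent is `fuel n Δ`, so this is the initial potential for `n`
-- candidates: `suc ⌊log₂ n ⌋` halvings bring `n` below 1.
n*a^[[1+a]*[1+log]]< : ∀ n a .{{_ : NonZero a}} →
                        n * a ^ (suc a * suc ⌊log₂ n ⌋) < suc a ^ (suc a * suc ⌊log₂ n ⌋)
n*a^[[1+a]*[1+log]]< n a = begin-strict
  n * a ^ (suc a * L)                <⟨ *-monoˡ-< (a ^ (suc a * L)) {{m^n≢0 a (suc a * L)}} (n<2^[1+⌊log₂n⌋] n) ⟩
  2 ^ L * a ^ (suc a * L)            ≡⟨ cong (2 ^ L *_) (^-*-assoc a (suc a) L) ⟨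
  2 ^ L * (a ^ suc a) ^ L            ≡⟨ ^-distribʳ-* 2 (a ^ suc a) L ⟨
  (2 * a ^ suc a) ^ L                ≤⟨ ^-monoˡ-≤ L (2*a^[1+a]≤[1+a]^[1+a] a) ⟩
  (suc a ^ suc a) ^ L                ≡⟨ ^-*-assoc (suc a) (suc a) L ⟩
  suc a ^ (suc a * L)                ∎
  where
  open ≤-Reasoning
  L = suc ⌊log₂ n ⌋

-- The left side counts the row of the root and, for each vertex, a search and a 2-ball. Each of
-- `1`, `Δ`, `Δ * Δ` and `Δ * L` is at most `Δ ^ 3 * L`, and their coefficients 2, 3, 1 and 2 add up
-- to 8.
total≤queryBound : ∀ n Δ → 2 ≤ n → 1 ≤ Δ →
                   n + n * (2 * Δ * suc ⌊log₂ n ⌋ + suc (Δ + Δ * Δ)) ≤ 8 * queryBound n Δ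
total≤queryBound n Δ n≥2 Δ≥1 = begin
  n + n * (2 * Δ * suc L + suc (Δ + Δ * Δ))                     ≡⟨ lemma₁ n Δ L ⟩
  n * (2 + 3 * Δ + Δ * Δ + 2 * (Δ * L))                         ≤⟨ *-monoʳ-≤ n terms ⟩
  n * (2 * (Δ³ * L) + 3 * (Δ³ * L) + Δ³ * L + 2 * (Δ³ * L))     ≡⟨ lemma₂ n (Δ³ * L) ⟩
  8 * (n * (Δ³ * L))                                            ≤⟨ *-monoʳ-≤ 8 step ⟩
  8 * queryBound n Δ                                            ∎
  where
  open ≤-Reasoning
  L  = ⌊log₂ n ⌋
  Δ³ = Δ ^ 3
  instance
    L≢0 : NonZero L
    L≢0 = >-nonZero (2≤⇒1≤⌊log₂⌋ n≥2)
    Δ≢0 : NonZero Δ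
    Δ≢0 = >-nonZero Δ≥1
    2^Δ≢0 : NonZero (2 ^ Δ)
    2^Δ≢0 = m^n≢0 2 Δ
    2^Δ+L²≢0 : NonZero (2 ^ Δ + L ^ 2)
    2^Δ+L²≢0 = >-nonZero (≤-trans (>-nonZero⁻¹ (2 ^ Δ)) (m≤m+n _ _))
  Δ≤Δ³ : Δ ≤ Δ³
  Δ≤Δ³ = ≤-trans (≤-reflexive (sym (^-identityʳ Δ))) (^-monoʳ-≤ Δ {1} {3} (s≤s z≤n))
  Δ≤x : Δ ≤ Δ³ * L
  Δ≤x = ≤-trans Δ≤Δ³ (m≤m*n Δ³ L)
  1≤x : 1 ≤ Δ³ * L
  1≤x = ≤-trans Δ≥1 Δ≤x
  Δ²≤x : Δ * Δ ≤ Δ³ * L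
  Δ²≤x = ≤-trans (≤-trans (≤-reflexive (sym (cong (Δ *_) (*-identityʳ Δ)))) (^-monoʳ-≤ Δ {2} {3} (s≤s (s≤s z≤n))))
                 (m≤m*n Δ³ L)
  terms : 2 + 3 * Δ + Δ * Δ + 2 * (Δ * L) ≤ 2 * (Δ³ * L) + 3 * (Δ³ * L) + Δ³ * L + 2 * (Δ³ * L)
  terms = +-mono-≤ (+-mono-≤ (+-mono-≤ (*-monoʳ-≤ 2 1≤x) (*-monoʳ-≤ 3 Δ≤x)) Δ²≤x)
                   (*-monoʳ-≤ 2 (*-monoˡ-≤ L Δ≤Δ³))
  lemma₁ : ∀ n Δ L → n + n * (2 * Δ * suc L + suc (Δ + Δ * Δ)) ≡ n * (2 + 3 * Δ + Δ * Δ + 2 * (Δ * L))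
  lemma₁ = solve-∀
  lemma₂ : ∀ n x → n * (2 * x + 3 * x + x + 2 * x) ≡ 8 * (n * x)
  lemma₂ = solve-∀
  lemma₃ : ∀ n x L → n * (x * L) ≡ x * (n * L)
  lemma₃ = solve-∀
  step : n * (Δ³ * L) ≤ queryBound n Δ
  step = begin
    n * (Δ³ * L)                              ≡⟨ lemma₃ n Δ³ L ⟩
    Δ³ * (n * L)                              ≤⟨ *-mono-≤ (m≤m*n Δ³ (2 ^ Δ)) (*-monoˡ-≤ L (m≤m*n n (2 ^ Δ + L ^ 2))) ⟩
    Δ³ * 2 ^ Δ * (n * (2 ^ Δ + L ^ 2) * L)    ∎

-- With `L = ⌊log₂ n ⌋`, eventually `Δ n ≤ C * ⌊log₂ L ⌋`, so that `2 ^ Δ n`, and with it `Δ n`, is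
-- at most `L ^ C`.
queryBound∈Õ : ∀ (Δ : ℕ → ℕ) → Δ ∈O (λ n → ⌊log₂ ⌊log₂ n ⌋ ⌋) → (λ n → queryBound n (Δ n)) ∈Õ (λ n → n)
-- The exponents come from `Δ ^ 3`, `2 ^ Δ`, the sum `2 ^ Δ + L ^ 2` and the last factor `L`; that
-- sum costs the constant 2. From `n = 2` on, `L ≥ 1`.
queryBound∈Õ Δ (C , n₀ , Δ≤) = C * 3 + C + (C + 2) + 1 , 2 , n₀ ⊔ 2 , bound
  where
  open ≤-Reasoning
  n<2^n : ∀ m → m < 2 ^ m
  n<2^n zero    = s≤s z≤n
  n<2^n (suc m) = begin
    1 + suc m          ≤⟨ +-mono-≤ (>-nonZero⁻¹ (2 ^ m) {{m^n≢0 2 m}}) (n<2^n m) ⟩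
    2 ^ m + 2 ^ m      ≡⟨ cong (λ x → 2 ^ m + x) (+-identityʳ _) ⟨
    2 ^ suc m          ∎

  bound : ∀ n → n ≥ n₀ ⊔ 2 → queryBound n (Δ n) ≤ 2 * (n * ⌊log₂ n ⌋ ^ (C * 3 + C + (C + 2) + 1))
  bound n n≥ = begin
    Δ n ^ 3 * 2 ^ Δ n * (n * (2 ^ Δ n + L ^ 2) * L)
      ≤⟨ *-mono-≤ (*-mono-≤ Δ³≤ 2^Δ≤) (*-monoˡ-≤ L (*-monoʳ-≤ n sum≤)) ⟩
    L ^ (C * 3) * L ^ C * (n * (L ^ (C + 2) + L ^ (C + 2)) * L)
      ≡⟨ lemma (L ^ (C * 3)) (L ^ C) n (L ^ (C + 2)) L ⟩
    2 * (n * (L ^ (C * 3) * L ^ C * L ^ (C + 2) * L ^ 1))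
      ≡⟨ cong (λ x → 2 * (n * x)) expand ⟨
    2 * (n * L ^ (C * 3 + C + (C + 2) + 1))
      ∎
    where
    L = ⌊log₂ n ⌋
    L≥1 : 1 ≤ L
    L≥1 = 2≤⇒1≤⌊log₂⌋ (≤-trans (m≤n⊔m n₀ 2) n≥)
    instance
      L≢0 : NonZero L
      L≢0 = >-nonZero L≥1
    2^Δ≤ : 2 ^ Δ n ≤ L ^ C
    2^Δ≤ = begin
      2 ^ Δ n                  ≤⟨ ^-monoʳ-≤ 2 (Δ≤ n (≤-trans (m≤m⊔n n₀ 2) n≥)) ⟩
      2 ^ (C * ⌊log₂ L ⌋)      ≡⟨ cong (2 ^_) (*-comm C ⌊log₂ L ⌋) ⟩
      2 ^ (⌊log₂ L ⌋ * C)      ≡⟨ ^-*-assoc 2 ⌊log₂ L ⌋ C ⟨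
      (2 ^ ⌊log₂ L ⌋) ^ C      ≤⟨ ^-monoˡ-≤ C (2^⌊log₂n⌋≤n L L≥1) ⟩
      L ^ C                    ∎
    Δ³≤ : Δ n ^ 3 ≤ L ^ (C * 3)
    Δ³≤ = begin
      Δ n ^ 3                  ≤⟨ ^-monoˡ-≤ 3 (≤-trans (<⇒≤ (n<2^n (Δ n))) 2^Δ≤) ⟩
      (L ^ C) ^ 3              ≡⟨ ^-*-assoc L C 3 ⟩
      L ^ (C * 3)              ∎
    sum≤ : 2 ^ Δ n + L ^ 2 ≤ L ^ (C + 2) + L ^ (C + 2)
    sum≤ = +-mono-≤ (≤-trans 2^Δ≤ (^-monoʳ-≤ L (m≤m+n C 2))) (^-monoʳ-≤ L (m≤n+m 2 C))
    expand : L ^ (C * 3 + C + (C + 2) + 1) ≡ L ^ (C * 3) * L ^ C * L ^ (C + 2) * L ^ 1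
    expand = trans (^-distribˡ-+-* L (C * 3 + C + (C + 2)) 1) (cong (_* L ^ 1)
      (trans (^-distribˡ-+-* L (C * 3 + C) (C + 2)) (cong (_* L ^ (C + 2)) (^-distribˡ-+-* L (C * 3) C))))
    lemma : ∀ a b n x L → a * b * (n * (x + x) * L) ≡ 2 * (n * (a * b * x * (L * 1)))
    lemma = solve-∀

-- The reconstruction algorithm

length-neighbourList : (G : Graph n) (x : Fin n) → length (neighbourList G x) ≡ degree G x
length-neighbourList {n} G x = go (edge G x) (λ i → i)
  where
  -- Generalised to an arbitrary `g`, since the tail of a tabulation is indexed by a smaller `Fin`.
  go : ∀ {m} (f : Fin n → Bool) (g : Fin m → Fin n) →
       length (filter (λ y → T? (f y)) (List.tabulate g)) ≡ ∣ Vec.tabulate (f ∘ g) ∣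
  go {zero}  f g = refl
  go {suc m} f g with f (g zero)
  ... | true  = cong suc (go f (g ∘ suc))
  ... | false = go f (g ∘ suc)

length-concatMap : (f : A → List B) {b : ℕ} → (∀ x → length (f x) ≤ b) →
                   ∀ xs → length (concatMap f xs) ≤ length xs * b
length-concatMap f f≤ []       = z≤n
length-concatMap f f≤ (x ∷ xs) = ≤-trans (≤-reflexive (length-++ (f x))) (+-mono-≤ (f≤ x) (length-concatMap f f≤ xs))

queryRow : Fin n → List (Fin n) → Algorithm n (Fin n → ℕ)
queryRow u []       = return λ _ → 0
queryRow u (x ∷ xs) = query u x λ d → queryRow u xs >>= λ f → return λ y → if does (y ≟ x) then d else f y

-- Row entries that have not been queried are 0.
record IsRow {n} (δ : Fin n → Fin n → ℕ) (u : Fin n) (xs : List (Fin n)) (f : Fin n → ℕ) : Set where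
  field
    queried : ∀ {y} → y ∈ xs → f y ≡ δ u y
    default : ∀ y → f y ≡ 0 ⊎ f y ≡ δ u y

queryRow-isRow : (δ : Fin n → Fin n → ℕ) (u : Fin n) → ∀ xs → Within δ (IsRow δ u xs) (length xs) (queryRow u xs)
queryRow-isRow δ u []       = return (record { queried = λ () ; default = λ _ → inj₁ refl })
queryRow-isRow δ u (x ∷ xs) = query (within-≤ (≤-reflexive (+-identityʳ _))
  (within->>= {l = 0} (queryRow-isRow δ u xs) (λ isRow → return (extend isRow))))
  where
  extend : ∀ {f} → IsRow δ u xs f → IsRow δ u (x ∷ xs) (λ y → if does (y ≟ x) then δ u x else f y)
  extend {f} isRow = record { queried = queried ; default = default }
    where
    queried : ∀ {y} → y ∈ x ∷ xs → (if does (y ≟ x) then δ u x else f y) ≡ δ u y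
    queried {y} y∈ with y ≟ x | y∈
    ... | yes refl | _         = refl
    ... | no y≢x   | here y≡x  = contradiction y≡x y≢x
    ... | no _     | there y∈′ = IsRow.queried isRow y∈′
    default : ∀ y → (if does (y ≟ x) then δ u x else f y) ≡ 0
                    ⊎ (if does (y ≟ x) then δ u x else f y) ≡ δ u y
    default y with y ≟ x
    ... | yes refl = inj₂ refl
    ... | no _     = IsRow.default isRow y

module _ (H : Graph n) (v : Fin n) (f : Fin n → ℕ) where

  -- The default 0 of a row fails the test `f y ≡ 1`. Requiring `y ≢ v` keeps `attach` loopless for
  -- every `f`.
  Linked : Fin n → Fin n → Set
  Linked x y = x ≡ v × f y ≡ 1 × y ≢ v

  linked? : ∀ x y → Dec (Linked x y)
  linked? x y = x ≟ v ×-dec f y ℕ.≟ 1 ×-dec ¬? (y ≟ v)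

  attach-edge? : ∀ x y → Dec (Adjacent H x y ⊎ Linked x y ⊎ Linked y x)
  attach-edge? x y = T? (edge H x y) ⊎-dec linked? x y ⊎-dec linked? y x

  attach : Graph n
  attach = record
    { edge        = λ x y → does (attach-edge? x y)
    ; symmetric   = λ x y → cong₂ _∨_ (symmetric H x y) (∨-comm (does (linked? x y)) (does (linked? y x)))
    ; irreflexive = λ x → dec-false (attach-edge? x x) λ
        { (inj₁ e)                           → adjacent⇒≢ H e refl
        ; (inj₂ (inj₁ (x≡v , _ , x≢v)))      → x≢v x≡v
        ; (inj₂ (inj₂ (x≡v , _ , x≢v)))      → x≢v x≡v
        }
    }

twoBall : Graph n → Fin n → List (Fin n)
twoBall H p = p ∷ neighbourList H p ++ concatMap (neighbourList H) (neighbourList H p)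

module _ (ℓ : Fin n → ℕ) where

  levelOrder : DecTotalOrder 0ℓ 0ℓ 0ℓ
  levelOrder = On.decTotalOrder ℕ.≤-decTotalOrder ℓ

  byLevel : List (Fin n)
  byLevel = Sort.sort levelOrder (allFin n)

  ∈-byLevel : ∀ x → x ∈ byLevel
  ∈-byLevel x = ∈-resp-↭ (↭-sym (Sort.sort-↭ levelOrder (allFin n))) (∈-allFin x)

  length-byLevel : length byLevel ≡ n
  length-byLevel = trans (↭-length (Sort.sort-↭ levelOrder (allFin n))) (length-tabulate {n = n} (λ x → x))

  byLevel-sorted : AllPairs (λ x y → ℓ x ≤ ℓ y) byLevel
  byLevel-sorted = Sorted.Sorted⇒AllPairs (DecTotalOrder.totalOrder levelOrder) (Sort.sort-↗ levelOrder (allFin n))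

module Insertion (r : Fin n) (Δ F : ℕ) (ℓ : Fin n → ℕ) where

  insertAt : ℕ → Graph n → Fin n → Algorithm n (Graph n)
  -- Level 0 contains only the root, which has no inserted neighbour yet.
  insertAt zero    H v = return H
  insertAt (suc k) H v =
    Search.searchParent H v Δ F r k (Search.below H v Δ (allFin n) r k) >>= λ p →
    queryRow v (twoBall H p) >>= λ f →
    return (attach H v f)

  insert : Graph n → Fin n → Algorithm n (Graph n)
  insert H v = insertAt (ℓ v) H v

  insertAll : Graph n → List (Fin n) → Algorithm n (Graph n)
  insertAll H []       = return H
  insertAll H (v ∷ vs) = insert H v >>= λ H′ → insertAll H′ vs

empty : ∀ n → Graph n
empty n = record { edge = λ _ _ → false ; symmetric = λ _ _ → refl ; irreflexive = λ _ → refl }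

fuel : ℕ → ℕ → ℕ
fuel n Δ = 2 * Δ * suc ⌊log₂ n ⌋

-- `queryBound n Δ` vanishes for `n ≤ 1`, so these graphs must be output without a query.
reconstruct : (n Δ : ℕ) → Algorithm n (EdgeSet n)
reconstruct zero          Δ = return λ _ _ → false
reconstruct (suc zero)    Δ = return λ _ _ → false
reconstruct n@(suc (suc _)) Δ =
  queryRow zero (allFin n) >>= λ ℓ →
  Insertion.insertAll zero Δ (fuel n Δ) ℓ (empty n) (byLevel ℓ) >>= λ H →
  return (edge H)

-- Correctness of insertion

module InsertionCorrect
  {G : Graph n} (chordal : Chordal G) {δ : Fin n → Fin n → ℕ} (isDistance : IsDistance G δ)
  {r : Fin n} {ℓ : Fin n → ℕ} (levels : Levels G r ℓ)
  (D F : ℕ) (maxDegree : MaxDegree≤ G (suc D)) (fuel-suffices : n * pred (2 * suc D) ^ F < (2 * suc D) ^ F)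
  where

  Δ = suc D
  open Insertion r Δ F ℓ
  open Levels levels

  δ≡1⇒adjacent : ∀ {x y} → δ x y ≡ 1 → Adjacent G x y
  δ≡1⇒adjacent {x} {y} δ≡1 with cons e nil ← subst (Walk G x y) δ≡1 (proj₁ (isDistance x y)) = e

  adjacent⇒δ≡1 : ∀ {x y} → Adjacent G x y → δ x y ≡ 1
  adjacent⇒δ≡1 {x} {y} e with δ x y | isDistance x y
  ... | zero  | nil , _ = contradiction refl (adjacent⇒≢ G e)
  ... | suc d | _ , min = ≤-antisym (min 1 (cons e nil)) (s≤s z≤n)

  record Knows (H : Graph n) (todo : List (Fin n)) : Set where
    field
      sound    : ∀ {x y} → Adjacent H x y → Adjacent G x y
      complete : ∀ {x y} → x ∉ todo → y ∉ todo → Adjacent G x y → Adjacent H x y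

  module _ {H : Graph n} {v : Fin n} {vs : List (Fin n)} (knows : Knows H (v ∷ vs))
           (processed : ∀ {x y} → x ∉ v ∷ vs → y ∈ v ∷ vs → ℓ x ≤ ℓ y)
           (sorted : All (λ y → ℓ v ≤ ℓ y) vs) where
    open Knows knows

    degree≤ : ∀ x → length (neighbourList H x) ≤ Δ
    degree≤ x = begin
      length (neighbourList H x)  ≤⟨ count-⊆ (λ y → T? (edge H x y)) (λ y → T? (edge G x y)) sound (allFin n) ⟩
      length (neighbourList G x)  ≡⟨ length-neighbourList G x ⟩
      degree G x                  ≤⟨ maxDegree x ⟩
      Δ                           ∎
      where open ≤-Reasoning

    length-twoBall : ∀ p → length (twoBall H p) ≤ suc (Δ + Δ * Δ)
    length-twoBall p = s≤s (begin
      length (N ++ concatMap (neighbourList H) N)        ≡⟨ length-++ N ⟩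
      length N + length (concatMap (neighbourList H) N)  ≤⟨ +-monoʳ-≤ (length N) (length-concatMap (neighbourList H) degree≤ N) ⟩
      length N + length N * Δ                            ≤⟨ +-mono-≤ (degree≤ p) (*-monoˡ-≤ Δ (degree≤ p)) ⟩
      Δ + Δ * Δ                                          ∎)
      where
      open ≤-Reasoning
      N = neighbourList H p

    -- `v` has the least level among the vertices still to be inserted.
    low⇒∉ : ∀ {x} → ℓ x < ℓ v → x ∉ v ∷ vs
    low⇒∉ x<v (here refl) = <-irrefl refl x<v
    low⇒∉ x<v (there x∈)  = <⇒≱ x<v (All.lookup sorted x∈)

    ∉-step : ∀ {x} → x ≢ v → x ∉ vs → x ∉ v ∷ vs
    ∉-step x≢v x∉ (here x≡v) = x≢v x≡v
    ∉-step x≢v x∉ (there x∈) = x∉ x∈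

    -- Only edges at v are missing from H.
    knows-step : ∀ {H′} → (∀ {x y} → Adjacent H′ x y → Adjacent G x y) →
                 (∀ {x y} → Adjacent H x y → Adjacent H′ x y) →
                 (∀ {w} → w ∉ v ∷ vs → Adjacent G v w → Adjacent H′ v w) → Knows H′ vs
    knows-step {H′} sound′ mono at-v = record { sound = sound′ ; complete = complete′ }
      where
      complete′ : ∀ {x y} → x ∉ vs → y ∉ vs → Adjacent G x y → Adjacent H′ x y
      complete′ {x} {y} x∉ y∉ e with x ≟ v | y ≟ v
      ... | no x≢v   | no y≢v   = mono (complete (∉-step x≢v x∉) (∉-step y≢v y∉) e)
      ... | yes refl | _        = at-v (∉-step (λ y≡v → adjacent⇒≢ G e (sym y≡v)) y∉) e
      ... | no x≢v   | yes refl = adjacent-sym H′ (at-v (∉-step x≢v x∉) (adjacent-sym G e))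

    -- The path given by `near-lower-neighbour` lies in `H`: `p` and `q` are below `v`, and `w` is
    -- already inserted.
    ∈-twoBall : ∀ {p w} → Adjacent G p v → ℓ p < ℓ v → w ∉ v ∷ vs → Adjacent G v w → w ∈ twoBall H p
    ∈-twoBall {p} pv p<v w∉ vw
      with near-lower-neighbour chordal levels (adjacent-sym G pv) p<v vw (processed w∉ (here refl))
    ... | inj₁ p≡w                        = here (sym p≡w)
    ... | inj₂ (inj₁ pw)                  = there (∈-++⁺ˡ (∈-neighbourList⁺ H (complete (low⇒∉ p<v) w∉ pw)))
    ... | inj₂ (inj₂ (q , q<v , pq , qw)) =
      there (∈-++⁺ʳ (neighbourList H p) (∈-concatMap⁺ (neighbourList H)
        (lose (∈-neighbourList⁺ H (complete (low⇒∉ p<v) (low⇒∉ q<v) pq))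
              (∈-neighbourList⁺ H (complete (low⇒∉ q<v) w∉ qw)))))

    attach-knows : ∀ {p f} → Adjacent G p v → ℓ p < ℓ v → IsRow δ v (twoBall H p) f → Knows (attach H v f) vs
    attach-knows {p} {f} pv p<v isRow = knows-step
      (λ {x} {y} e → sound′ (true-does (attach-edge? H v f x y) e))
      (λ {x} {y} e → does-true (attach-edge? H v f x y) (inj₁ e))
      (λ {w} w∉ vw → does-true (attach-edge? H v f v w) (inj₂ (inj₁
        (refl , trans (IsRow.queried isRow (∈-twoBall pv p<v w∉ vw)) (adjacent⇒δ≡1 vw) ,
         λ w≡v → adjacent⇒≢ G vw (sym w≡v)))))
      where
      linked⇒adjacent : ∀ {x y} → Linked H v f x y → Adjacent G x y
      linked⇒adjacent {y = y} (refl , f≡1 , _) with IsRow.default isRow y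
      ... | inj₁ f≡0 = contradiction (trans (sym f≡1) f≡0) λ ()
      ... | inj₂ f≡δ = δ≡1⇒adjacent (trans (sym f≡δ) f≡1)
      sound′ : ∀ {x y} → Adjacent H x y ⊎ Linked H v f x y ⊎ Linked H v f y x → Adjacent G x y
      sound′ (inj₁ e)        = sound e
      sound′ (inj₂ (inj₁ l)) = linked⇒adjacent l
      sound′ (inj₂ (inj₂ l)) = adjacent-sym G (linked⇒adjacent l)

    level0⇒root : ∀ {x} → ℓ x ≡ 0 → r ≡ x
    level0⇒root {x} eq with nil ← subst (Walk G r x) eq (attained x) = refl

    -- `k` stands for `ℓ v`, so that matching on it unfolds `insertAt`.
    insertAt-knows : ∀ k → ℓ v ≡ k → Within δ (λ H′ → Knows H′ vs) (F + suc (Δ + Δ * Δ)) (insertAt k H v)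
    -- An inserted neighbour of the root would have level 0 too, hence be the root.
    insertAt-knows zero ℓv≡0 = return (knows-step {H} sound (λ e → e) λ {w} w∉ vw → contradiction
      (trans (sym (level0⇒root ℓv≡0)) (level0⇒root (n≤0⇒n≡0 (subst (ℓ w ≤_) ℓv≡0 (processed w∉ (here refl))))))
      (adjacent⇒≢ G vw))
    insertAt-knows (suc k) ℓv≡1+k = within->>= {l = suc (Δ + Δ * Δ)}
      -- The initial list has at most `n` elements, so `fuel-suffices` gives the initial potential.
      (Correct.searchParent-finds F start (inj₂ (≤-<-trans
        (*-monoˡ-≤ (pred (2 * Δ) ^ F) (≤-trans (length-filter (λ s → walk? H r s k) (allFin n))
          (≤-reflexive (length-tabulate {n = n} (λ x → x)))))
        fuel-suffices)))
      λ {p} (pv , p<v) → within-≤ (≤-trans (≤-reflexive (+-identityʳ _)) (length-twoBall p))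
        (within->>= {l = 0} (queryRow-isRow δ v (twoBall H p)) (λ isRow → return (attach-knows pv p<v isRow)))
      where
      module Correct = SearchCorrect {G = G} {H} isDistance {ℓ} lipschitz v D sound
        (λ x<v y<v → complete (low⇒∉ x<v) (low⇒∉ y<v)) degree≤
      start : Correct.Invariant r k (Search.below H v Δ (allFin n) r k)
      start = record
        { to-v       = subst (Walk G r v) ℓv≡1+k (attained v)
        ; level      = ≤-reflexive (trans (cong (_+ suc k) root) (sym ℓv≡1+k))
        ; candidate  = λ s∈ → proj₂ (∈-filter⁻ (λ s → walk? H r s k) {xs = allFin n} s∈)
        ; exhaustive = λ p _ → ∈-filter⁺ (λ s → walk? H r s k) (∈-allFin _) p
        }

  insertAll-knows : ∀ {H} todo → Knows H todo → (∀ {x y} → x ∉ todo → y ∈ todo → ℓ x ≤ ℓ y) →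
                    AllPairs (λ x y → ℓ x ≤ ℓ y) todo →
                    Within δ (λ H′ → Knows H′ []) (length todo * (F + suc (Δ + Δ * Δ))) (insertAll H todo)
  insertAll-knows []       knows _ _ = return knows
  insertAll-knows (v ∷ vs) knows processed (v≤vs ∷ sorted) =
    within->>= (insertAt-knows knows processed v≤vs (ℓ v) refl) λ knows′ →
      insertAll-knows vs knows′ processed′ sorted
    where
    processed′ : ∀ {x y} → x ∉ vs → y ∈ vs → ℓ x ≤ ℓ y
    processed′ {x} x∉ y∈ with x ≟ v
    ... | yes refl = All.lookup v≤vs y∈
    ... | no x≢v   = processed (λ { (here x≡v) → x≢v x≡v ; (there x∈) → x∉ x∈ }) (there y∈)

-- Correctness and cost of the whole algorithm

row⇒levels : ∀ {δ : Fin n → Fin n → ℕ} {r ℓ} → IsDistance G δ → IsRow δ r (allFin n) ℓ → Levels G r ℓ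
row⇒levels {G = G} {δ} {r} {ℓ} isDistance isRow = record
  { root      = n≤0⇒n≡0 (≤-trans (≤-reflexive (ℓ≡ r)) (proj₂ (isDistance r r) 0 nil))
  ; lipschitz = λ {x} {y} e → subst₂ (λ i j → j ≤ suc i) (sym (ℓ≡ x)) (sym (ℓ≡ y))
                  (proj₂ (isDistance r y) _ (snoc (proj₁ (isDistance r x)) e))
  ; attained  = λ x → subst (Walk G r x) (sym (ℓ≡ x)) (proj₁ (isDistance r x))
  }
  where
  ℓ≡ : ∀ x → ℓ x ≡ δ r x
  ℓ≡ x = IsRow.queried isRow (∈-allFin x)

-- Excludes `Δ = 0` on two or more vertices, where `queryBound` is 0.
connected⇒degree>0 : (G : Graph (suc (suc n))) → Connected G → 0 < degree G zero
connected⇒degree>0 G conn with conn zero (suc zero)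
... | _ , cons e _ = subst (0 <_) (length-neighbourList G zero) (∈-length (∈-neighbourList⁺ G e))

T-ext : ∀ {x y} → (T x → T y) → (T y → T x) → x ≡ y
T-ext {true}  {true}  _ _ = refl
T-ext {true}  {false} f _ with () ← f _
T-ext {false} {true}  _ g with () ← g _
T-ext {false} {false} _ _ = refl

reconstruct-within : ∀ n Δ (G : Graph n) (conn : Connected G) → Chordal G → MaxDegree≤ G Δ →
                     Within (distance G conn) (λ E → ∀ u v → E u v ≡ edge G u v)
                       (8 * queryBound n Δ) (reconstruct n Δ)
reconstruct-within zero          Δ       G conn chordal maxDegree = return λ ()
reconstruct-within (suc zero)    Δ       G conn chordal maxDegree =
  return λ { zero zero → sym (irreflexive G zero) }
reconstruct-within (suc (suc m)) zero    G conn chordal maxDegree =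
  contradiction (maxDegree zero) (<⇒≱ (connected⇒degree>0 G conn))
reconstruct-within n@(suc (suc m)) Δ@(suc D) G conn chordal maxDegree =
  within-≤ (≤-trans (≤-reflexive (cong₂ _+_ (length-tabulate {n = n} (λ x → x)) (+-identityʳ _)))
                    (total≤queryBound n Δ (s≤s (s≤s z≤n)) (s≤s z≤n)))
    (within->>= {l = n * (fuel n Δ + suc (Δ + Δ * Δ)) + 0} (queryRow-isRow δ zero (allFin n)) inserted)
  where
  δ = distance G conn

  isDistance : IsDistance G δ
  isDistance u v = proj₂ (shortestWalk G conn u v)

  instance
    2Δ-1≢0 : NonZero (pred (2 * Δ))
    2Δ-1≢0 = pred[2*suc]≢0 D

  inserted : ∀ {ℓ} → IsRow δ zero (allFin n) ℓ →
             Within δ (λ E → ∀ u v → E u v ≡ edge G u v) (n * (fuel n Δ + suc (Δ + Δ * Δ)) + 0)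
               (Insertion.insertAll zero Δ (fuel n Δ) ℓ (empty n) (byLevel ℓ) >>= λ H → return (edge H))
  inserted {ℓ} isRow = within->>= {l = 0} allInserted λ knows →
    return λ u v → T-ext (Knows.sound knows) (Knows.complete knows (λ ()) (λ ()))
    where
    open InsertionCorrect {G = G} chordal isDistance (row⇒levels isDistance isRow) D (fuel n Δ) maxDegree
      (n*a^[[1+a]*[1+log]]< n (pred (2 * Δ)))
      using (module Knows; Knows; insertAll-knows)

    unprocessed : {X : Set} {x : Fin n} → x ∉ byLevel ℓ → X
    unprocessed {x = x} x∉ = contradiction (∈-byLevel ℓ x) x∉

    allInserted : Within δ (λ H → Knows H []) (n * (fuel n Δ + suc (Δ + Δ * Δ)))
                    (Insertion.insertAll zero Δ (fuel n Δ) ℓ (empty n) (byLevel ℓ))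
    allInserted = within-≤ (≤-reflexive (cong (_* (fuel n Δ + suc (Δ + Δ * Δ))) (length-byLevel ℓ)))
      -- Every vertex is still to be inserted, so completeness of the empty graph and the order
      -- condition hold vacuously.
      (insertAll-knows (byLevel ℓ) (record { sound = λ () ; complete = λ x∉ → unprocessed x∉ })
        (λ x∉ → unprocessed x∉) (byLevel-sorted ℓ))

theorem3 : (Σ[ reconstruct ∈ ((n Δ : ℕ) → Algorithm n (EdgeSet n)) ] ∃[ C ]
    ∀ n Δ (G : Graph n) (conn : Connected G) → Chordal G → MaxDegree≤ G Δ →
    Reconstructs G conn (reconstruct n Δ)
    × expectedQueries (distance G conn) (reconstruct n Δ)
    ℚ.≤ + (C * queryBound n Δ) ℚ./ 1)
    × (∀ (Δ : ℕ → ℕ) → Δ ∈O (λ n → ⌊log₂ ⌊log₂ n ⌋ ⌋) →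
    (λ n → queryBound n (Δ n)) ∈Õ (λ n → n))
theorem3 =
  (reconstruct , 8 , λ n Δ G conn chordal maxDegree →
    let within = reconstruct-within n Δ G conn chordal maxDegree in
    within⇒alwaysReturns within , within⇒expectedQueries≤ within)
  , queryBound∈Õ
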